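{- Let $A_n = A_n(h,T)$ be an apex tree. Then the negative frustration index $l(-A_n)$ equals the maximum cardinality of a collection of pairwise edge-disjoint and pairwise endpoint-disjoint odd paths in $T$.
   Context: All graphs are finite, simple and undirected. A signed graph $\Sigma=(G,\sigma)$ is a graph $G$ with a signature $\sigma:E(G)\to\{+1,-1\}$. The sign of a cycle is the product of the signs of its edges; $\Sigma$ is balanced if all its cycles are positive. The frustration index $l(\Sigma)$ is the minimum number of edges whose deletion makes $\Sigma$ balanced. $-G$ is the graph $G$ with all edges signed $-1$; $l(-G)$ is the negative frustration index of $G$. An odd path is a path with an odd number of edges. Two paths are endpoint-disjoint if no vertex is an endpoint of both (an endpoint of one may be an internal vertex of the other). Apex tree: $A_n(h,T)$ denotes a graph with a vertex $h$ of degree $n$ such that deleting $h$ and the edges incident to it leaves the tree $T$. Standing assumptions: all leaves of $T$ are neighbours of $h$; the graph is $2$-connected (the trivial case $A_1=K_2$ is allowed); and every vertex of degree $2$ in the graph is contained in a triangle.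
   Formalization: The odd paths in T are required to have both endpoints adjacent to h; with arbitrary endpoints in T the stated equality is false, as there is an apex tree with frustration index 4 and five such disjoint odd paths. -}

module Defs where

open import Data.Fin using (Fin; punchIn)
open import Data.Fin.Properties using (_≟_)
open import Data.List using (List; []; _∷_; length; filter; allFin)
open import Data.List.Membership.Propositional using (_∈_)
open import Data.List.Relation.Unary.All using (All)
open import Data.List.Relation.Unary.AllPairs using (AllPairs)
open import Data.List.Relation.Unary.Any using (Any; any?)
import Data.List.Relation.Unary.Any as Any
open import Data.List.Relation.Unary.Unique.Propositional using (Unique)
open import Data.Nat using (ℕ; zero; suc; _≤_; parity)
open import Data.Parity using (1ℙ)
open import Data.Product using (_×_; _,_; ∃-syntax; proj₁; proj₂)
open import Data.Sign using (Sign)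
import Data.Sign as Sign
open import Data.Sum using (_⊎_; inj₁; inj₂)
open import Level using (0ℓ)
open import Relation.Binary.Construct.Closure.ReflexiveTransitive using (Star; ε; _◅_)
open import Relation.Binary.Core using (Rel)
open import Relation.Binary.Definitions using (Decidable; Symmetric; Irreflexive)
open import Relation.Binary.PropositionalEquality using (_≡_; _≢_; refl)
open import Relation.Nullary using (¬_; Dec)
open import Relation.Nullary.Decidable using (_×-dec_; _⊎-dec_; ¬?)

IsMinimum : (ℕ → Set) → ℕ → Set
IsMinimum P k = P k × (∀ {j} → P j → k ≤ j)

IsMaximum : (ℕ → Set) → ℕ → Set
IsMaximum P k = P k × (∀ {j} → P j → j ≤ k)

record Graph (N : ℕ) : Set₁ where
  field
    Adj    : Rel (Fin N) 0ℓ
    adj?   : Decidable Adj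
    sym    : Symmetric Adj
    irrefl : Irreflexive _≡_ Adj

open Graph public using (Adj)

degree : ∀ {N} → Graph N → Fin N → ℕ
degree {N} G v = length (filter (Graph.adj? G v) (allFin N))

-- Vertex v of G -ᵥ x is vertex punchIn x v of G.
_-ᵥ_ : ∀ {m} → Graph (suc m) → Fin (suc m) → Graph m
G -ᵥ x = record
  { Adj    = λ u v → Adj G (punchIn x u) (punchIn x v)
  ; adj?   = λ u v → Graph.adj? G (punchIn x u) (punchIn x v)
  ; sym    = Graph.sym G
  ; irrefl = λ { refl → Graph.irrefl G refl }
  }

-- Edges are written as ordered pairs of endpoints, identified by SameEdge.
SameEdge : ∀ {N} → Rel (Fin N × Fin N) 0ℓ
SameEdge (u , v) (x , y) = (u ≡ x × v ≡ y) ⊎ (u ≡ y × v ≡ x)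

sameEdge? : ∀ {N} → Decidable (SameEdge {N})
sameEdge? (u , v) (x , y) = (u ≟ x ×-dec v ≟ y) ⊎-dec (u ≟ y ×-dec v ≟ x)

SameEdge-flip : ∀ {N} {u v : Fin N} {e} → SameEdge (u , v) e → SameEdge (v , u) e
SameEdge-flip (inj₁ (p , q)) = inj₂ (q , p)
SameEdge-flip (inj₂ (p , q)) = inj₁ (q , p)

IsEdgeSet : ∀ {N} → Graph N → List (Fin N × Fin N) → Set
IsEdgeSet G F = All (λ e → Adj G (proj₁ e) (proj₂ e)) F
              × AllPairs (λ e f → ¬ SameEdge e f) F

_∖_ : ∀ {N} → Graph N → List (Fin N × Fin N) → Graph N
G ∖ F = record
  { Adj    = λ u v → Adj G u v × ¬ Any (SameEdge (u , v)) F
  ; adj?   = λ u v → Graph.adj? G u v ×-dec ¬? (any? (sameEdge? (u , v)) F)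
  ; sym    = λ { (a , ∉F) → Graph.sym G a , λ ∈F → ∉F (Any.map SameEdge-flip ∈F) }
  ; irrefl = λ { eq (a , _) → Graph.irrefl G eq a }
  }

Walk : ∀ {N} → Graph N → Rel (Fin N) 0ℓ
Walk G = Star (Adj G)

module _ {N : ℕ} {G : Graph N} where

  vertices : ∀ {u v} → Walk G u v → List (Fin N)
  vertices {u} ε       = u ∷ []
  vertices {u} (_ ◅ w) = u ∷ vertices w

  edges : ∀ {u v} → Walk G u v → List (Fin N × Fin N)
  edges ε                   = []
  edges (_◅_ {u} {v} _ w) = (u , v) ∷ edges w

record Path {N} (G : Graph N) : Set where
  field
    start end : Fin N
    walk      : Walk G start end
    simple    : Unique (vertices {G = G} walk)

  pathEdges : List (Fin N × Fin N)
  pathEdges = edges {G = G} walk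

  edgeCount : ℕ
  edgeCount = length pathEdges

open Path public using (pathEdges; edgeCount)

-- A cycle is a path of length at least 2 closed up by an edge from its end
-- to its start.
record Cycle {N} (G : Graph N) : Set where
  field
    path    : Path G
    long    : 2 ≤ edgeCount path
    closing : Adj G (Path.end path) (Path.start path)

Connected : ∀ {N} → Graph N → Set
Connected G = ∀ u v → Walk G u v

TwoConnected : ∀ {m} → Graph (suc m) → Set
TwoConnected {m} G = 3 ≤ suc m × Connected G × (∀ x → Connected (G -ᵥ x))

IsK₂ : ∀ {N} → Graph N → Set
IsK₂ {N} G = N ≡ 2 × (∀ u v → u ≢ v → Adj G u v)

IsTree : ∀ {N} → Graph N → Set
IsTree {N} G = 1 ≤ N × Connected G × ¬ Cycle G

InTriangle : ∀ {N} → Graph N → Fin N → Set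
InTriangle G v = ∃[ u ] ∃[ w ] (Adj G v u × Adj G u w × Adj G w v)

record SignedGraph (N : ℕ) : Set₁ where
  field
    graph    : Graph N
    sign     : ∀ {u v} → Adj graph u v → Sign
    sign-sym : ∀ {u v} (e : Adj graph u v) (e′ : Adj graph v u) → sign e ≡ sign e′

module _ {N : ℕ} (Σ : SignedGraph N) where
  open SignedGraph Σ

  walkSign : ∀ {u v} → Walk graph u v → Sign
  walkSign ε       = Sign.+
  walkSign (e ◅ w) = sign e Sign.* walkSign w

  cycleSign : Cycle graph → Sign
  cycleSign C = sign (Cycle.closing C) Sign.* walkSign (Path.walk (Cycle.path C))

  Balanced : Set
  Balanced = ∀ C → cycleSign C ≡ Sign.+

  deleteEdges : List (Fin N × Fin N) → SignedGraph N
  deleteEdges F = record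
    { graph    = graph ∖ F
    ; sign     = λ { (e , _) → sign e }
    ; sign-sym = λ { (e , _) (e′ , _) → sign-sym e e′ }
    }

BalancedByDeleting : ∀ {N} → SignedGraph N → ℕ → Set
BalancedByDeleting Σ k =
  ∃[ F ] (IsEdgeSet (SignedGraph.graph Σ) F × length F ≡ k × Balanced (deleteEdges Σ F))

IsFrustrationIndex : ∀ {N} → SignedGraph N → ℕ → Set
IsFrustrationIndex Σ = IsMinimum (BalancedByDeleting Σ)

allNegative : ∀ {N} → Graph N → SignedGraph N
allNegative G = record
  { graph    = G
  ; sign     = λ _ → Sign.-
  ; sign-sym = λ _ _ → refl
  }

OddPath : ∀ {N} {G : Graph N} → Path G → Set
OddPath P = parity (edgeCount P) ≡ 1ℙ

IsEndpoint : ∀ {N} {G : Graph N} → Fin N → Path G → Set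
IsEndpoint x P = x ≡ Path.start P ⊎ x ≡ Path.end P

EdgeDisjoint : ∀ {N} {G : Graph N} → Rel (Path G) 0ℓ
EdgeDisjoint P Q = ∀ {e f} → e ∈ pathEdges P → f ∈ pathEdges Q → ¬ SameEdge e f

EndpointDisjoint : ∀ {N} {G : Graph N} → Rel (Path G) 0ℓ
EndpointDisjoint P Q = ∀ {x} → IsEndpoint x P → ¬ IsEndpoint x Q

record ApexTree (n : ℕ) : Set₁ where
  field
    {m}      : ℕ
    graph    : Graph (suc m)
    h        : Fin (suc m)
    degree-h : degree graph h ≡ n

  T : Graph m
  T = graph -ᵥ h

  NeighbourOfApex : Fin m → Set
  NeighbourOfApex v = Adj graph h (punchIn h v)

  field
    isTree       : IsTree T
    leaves       : ∀ v → degree T v ≡ 1 → NeighbourOfApex v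
    twoConnected : TwoConnected graph ⊎ IsK₂ graph
    triangles    : ∀ v → degree graph v ≡ 2 → InTriangle graph v

-- The paths join neighbours of h, so that each one closes up through h to an
-- odd cycle.  With arbitrary endpoints in T the min-max equality fails: let T
-- have edges cd, ca₁, ca₂, da₃, da₄, aᵢbᵢ (1 ≤ i ≤ 4) and let h be adjacent to
-- all aᵢ and bᵢ.  The frustration index is 4, but cd, a₁b₁, …, a₄b₄ are five
-- edge-disjoint, endpoint-disjoint odd paths.
record IsOddPathPacking {n} (A : ApexTree n) (Ps : List (Path (ApexTree.T A))) : Set where
  open ApexTree A
  field
    odd              : All OddPath Ps
    joinNeighbours   : All (λ P → NeighbourOfApex (Path.start P) × NeighbourOfApex (Path.end P)) Ps
    edgeDisjoint     : AllPairs EdgeDisjoint Ps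
    endpointDisjoint : AllPairs EndpointDisjoint Ps

-- Disjoint odd paths are distinct, so the length of a packing is its cardinality.
HasOddPathPacking : ∀ {n} → ApexTree n → ℕ → Set
HasOddPathPacking A k = ∃[ Ps ] (IsOddPathPacking A Ps × length Ps ≡ k)

{-# OPTIONS --safe #-}
module Submission where

open import Defs
open import Data.Fin using (Fin; punchIn; punchOut; fromℕ<)
open import Data.Fin.Properties using (_≟_; punchIn-injective; punchInᵢ≢i; punchIn-punchOut)
open import Data.List using (List; []; _∷_; _++_; length; map; filter; allFin)
open import Data.List.Membership.Propositional using (_∈_; _∉_; find; lose)
open import Data.List.Membership.Propositional.Properties
  using (∈-∃++; ∈-filter⁺; ∈-filter⁻; ∈-allFin)
open import Data.List.Relation.Binary.Permutation.Propositional
  using (_↭_; prep; swap; ↭-refl; ↭-trans; ↭-sym; ↭⇒↭ₛ)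
open import Data.List.Relation.Binary.Permutation.Propositional.Properties
  using (All-resp-↭; Any-resp-↭; ↭-length; shift)
import Data.List.Relation.Binary.Permutation.Setoid.Properties as Permₛ
open import Data.List.Relation.Binary.Subset.Propositional using (_⊆_)
open import Data.List.Relation.Unary.All as All using (All; []; _∷_)
open import Data.List.Relation.Unary.All.Properties as All
  using (anti-mono; ¬Any⇒All¬; All-swap)
open import Data.List.Relation.Unary.AllPairs as AllPairs using (AllPairs; []; _∷_)
import Data.List.Relation.Unary.AllPairs.Properties as AllPairs
open import Data.List.Relation.Unary.Any as Any using (Any; any?; here; there)
import Data.List.Relation.Unary.Any.Properties as Any
open import Data.List.Relation.Unary.Unique.Propositional using (Unique)
open import Data.List.Relation.Unary.Unique.Propositional.Properties using (allFin⁺; map⁺)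
open import Data.Nat using (ℕ; suc; _≤_; s≤s; z≤n; parity)
open import Data.Nat.Properties using (≤-refl; ≤-trans; ≤-antisym; ≤-reflexive; n≤1+n; m≤n⇒m≤1+n)
open import Data.Parity using (Parity; 0ℙ; 1ℙ; _⁻¹; toSign) renaming (_+_ to _⊕_)
import Data.Parity.Properties as ℙ
open import Data.Product using (_×_; _,_; ∃-syntax; proj₁; proj₂)
import Data.Sign as Sign
open import Data.Sum using (_⊎_; inj₁; inj₂)
import Data.Sum as Sum
open import Data.Vec.Functional using (updateAt; insertAt)
open import Data.Vec.Functional.Properties
  using (updateAt-updates; updateAt-minimal; insertAt-lookup; insertAt-punchIn)
open import Data.Unit using (⊤)
open import Function using (_∘_; const)
open import Relation.Binary.Construct.Closure.ReflexiveTransitive using (ε; _◅_; _◅◅_)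
open import Relation.Binary.Definitions using (Symmetric)
open import Relation.Binary.PropositionalEquality
  using (_≡_; _≢_; refl; sym; trans; cong; cong₂; subst; setoid; resp₂; ≢-sym; module ≡-Reasoning)
open import Relation.Nullary using (¬_; Dec; yes; no; contradiction)
open import Relation.Nullary.Decidable using (_×-dec_; ¬?; decidable-stable)

-- T is bipartite, and an odd path is one joining vertices of different classes.  A graph
-- G ∖ F is bipartite iff the vertices of T have sides (the colour relative to the
-- bipartition of T) such that F contains the tree edges joining different sides
-- and the edges from h to neighbours whose side is not their class.  So this is a
-- minimum cut problem, dual to packing paths, and on a tree it is solved by
-- removing leaves: every neighbour of h starts a path; two paths of different
-- classes meeting at a vertex are joined, and of the paths left over at a leaf
-- one is extended to the leaf's parent while the others are given up.

-- Lists up to permutation, and a counting bound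

module _ {a} {A : Set a} where

  AllPairs-resp-↭ : ∀ {r} {R : A → A → Set r} → Symmetric R →
                    ∀ {xs ys} → xs ↭ ys → AllPairs R xs → AllPairs R ys
  AllPairs-resp-↭ {R = R} R-sym σ = Permₛ.AllPairs-resp-↭ (setoid A) R-sym (resp₂ R) (↭⇒↭ₛ σ)

  AllPairs-lookup : ∀ {r} {R : A → A → Set r} → Symmetric R →
                    ∀ {xs x y} → AllPairs R xs → x ∈ xs → y ∈ xs → x ≡ y ⊎ R x y
  AllPairs-lookup R-sym (_ ∷ _) (here refl) (here refl) = inj₁ refl
  AllPairs-lookup R-sym (r ∷ _) (here refl) (there y∈)  = inj₂ (All.lookup r y∈)
  AllPairs-lookup R-sym (r ∷ _) (there x∈)  (here refl) = inj₂ (R-sym (All.lookup r x∈))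
  AllPairs-lookup R-sym (_ ∷ rs) (there x∈) (there y∈)  = AllPairs-lookup R-sym rs x∈ y∈

  ∈⇒↭ : ∀ {x : A} {xs} → x ∈ xs → ∃[ ys ] xs ↭ x ∷ ys
  ∈⇒↭ {x} x∈xs with ys , zs , refl ← ∈-∃++ x∈xs = ys ++ zs , shift x ys zs

  pair-or-none : ∀ {r} {R : A → A → Set r} → (∀ x y → Dec (R x y)) → ∀ xs →
                 (∃[ x ] ∃[ y ] ∃[ ys ] (xs ↭ x ∷ y ∷ ys × R x y)) ⊎ AllPairs (λ x y → ¬ R x y) xs
  pair-or-none R? []       = inj₂ []
  pair-or-none R? (x ∷ xs) with any? (R? x) xs
  ... | yes some with y , y∈ , r ← find some with ys , σ ← ∈⇒↭ y∈ = inj₁ (x , y , ys , prep x σ , r)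
  ... | no none with pair-or-none R? xs
  ...   | inj₂ free = inj₂ (¬Any⇒All¬ xs none ∷ free)
  ...   | inj₁ (y , z , ys , σ , r) =
          inj₁ (y , z , x ∷ ys , ↭-trans (prep x σ) (↭-trans (swap x y ↭-refl) (prep y (swap x z ↭-refl))) , r)

  Avoid : (A → A → Set) → List A → List A → Set a
  Avoid R xs ys = All (λ x → All (λ y → ¬ R x y) ys) xs

  Avoid-sym : ∀ {R : A → A → Set} → Symmetric R → Symmetric (Avoid R)
  Avoid-sym R-sym av = All.map (All.map (_∘ R-sym)) (All-swap av)

-- Pigeonhole: an entry `z` hit by the first `x` is hit by no later one, so removing it from `ys`
-- leaves the hits of all the others intact.
length-≤-by-hitting : ∀ {a b r} {A : Set a} {B : Set b} {R : A → B → Set r} {xs ys} →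
                      AllPairs (λ x y → ∀ z → R x z → ¬ R y z) xs →
                      All (λ x → Any (R x) ys) xs → length xs ≤ length ys
length-≤-by-hitting [] [] = z≤n
length-≤-by-hitting {R = R} (x# ∷ xs#) (hit ∷ hits) with z , z∈ , xRz ← find hit with zs , σ ← ∈⇒↭ z∈ =
  subst (_ ≤_) (sym (↭-length σ))
    (s≤s (length-≤-by-hitting xs# (All.zipWith (λ (x#y , y-hit) → avoid (x#y z xRz) (Any-resp-↭ σ y-hit)) (x# , hits))))
  where
  avoid : ∀ {y} → ¬ R y z → Any (R y) (z ∷ zs) → Any (R y) zs
  avoid ¬r (here r)  = contradiction r ¬r
  avoid ¬r (there i) = i

-- Edges up to orientation

SameEdge-refl : ∀ {N} {e : Fin N × Fin N} → SameEdge e e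
SameEdge-refl = inj₁ (refl , refl)

SameEdge-sym : ∀ {N} → Symmetric (SameEdge {N})
SameEdge-sym (inj₁ (refl , refl)) = inj₁ (refl , refl)
SameEdge-sym (inj₂ (refl , refl)) = inj₂ (refl , refl)

SameEdge-trans : ∀ {N} {d e f : Fin N × Fin N} → SameEdge d e → SameEdge e f → SameEdge d f
SameEdge-trans (inj₁ (refl , refl)) e~f = e~f
SameEdge-trans (inj₂ (refl , refl)) e~f = SameEdge-flip e~f

-- The cut is built as a list without control of repetitions, whereas `IsEdgeSet` allows none, not
-- even with the opposite orientation.
dedup-edges : ∀ {N} (F : List (Fin N × Fin N)) →
  ∃[ F′ ] (F′ ⊆ F × AllPairs (λ e f → ¬ SameEdge e f) F′ × length F′ ≤ length F ×
           (∀ {e} → Any (SameEdge e) F → Any (SameEdge e) F′))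
dedup-edges [] = [] , (λ ()) , [] , z≤n , λ ()
dedup-edges (f ∷ F) with F′ , F′⊆F , distinct , len , cover ← dedup-edges F with any? (sameEdge? f) F′
... | yes f∈F′ = F′ , there ∘ F′⊆F , distinct , m≤n⇒m≤1+n len , λ where
  (here e~f)  → Any.map (SameEdge-trans e~f) f∈F′
  (there e∈F) → cover e∈F
... | no f∉F′ = f ∷ F′ , (λ { (here p) → here p ; (there p) → there (F′⊆F p) }) ,
  ¬Any⇒All¬ F′ f∉F′ ∷ distinct , s≤s len , λ where
  (here e~f)  → here e~f
  (there e∈F) → there (cover e∈F)

-- Walks

-- Walks list their edges as ordered pairs, so reversing a walk preserves only those properties of
-- edges that ignore orientation.
ClosedUnderFlip : ∀ {N} → (Fin N × Fin N → Set) → Set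
ClosedUnderFlip P = ∀ {u v} → P (u , v) → P (v , u)

parity-suc : ∀ n → parity (suc n) ≡ parity n ⁻¹
parity-suc n = trans (sym (ℙ.⁻¹-involutive _)) (cong _⁻¹ (ℙ.suc-homo-⁻¹ n))

module Walks {N : ℕ} (G : Graph N) where

  verts : ∀ {u v} → Walk G u v → List (Fin N)
  verts = vertices {G = G}

  edgs : ∀ {u v} → Walk G u v → List (Fin N × Fin N)
  edgs = edges {G = G}

  All-edges-◅◅ : ∀ {P : Fin N × Fin N → Set} {u v w} (p : Walk G u v) (q : Walk G v w) →
                 All P (edgs p) → All P (edgs q) → All P (edgs (p ◅◅ q))
  All-edges-◅◅ ε       q []         Pq = Pq
  All-edges-◅◅ (_ ◅ p) q (Pe ∷ Pp) Pq = Pe ∷ All-edges-◅◅ p q Pp Pq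

  rev : ∀ {u v} → Walk G u v → Walk G v u
  rev ε       = ε
  rev (e ◅ w) = rev w ◅◅ (Graph.sym G e ◅ ε)

  All-edges-rev : ∀ {P : Fin N × Fin N → Set} → ClosedUnderFlip P →
                  ∀ {u v} (w : Walk G u v) → All P (edgs w) → All P (edgs (rev w))
  All-edges-rev flip ε       []        = []
  All-edges-rev flip (_ ◅ w) (Pe ∷ Pw) = All-edges-◅◅ (rev w) _ (All-edges-rev flip w Pw) (flip Pe ∷ [])

  suffix : ∀ {u v x} (w : Walk G u v) → Unique (verts w) → x ∈ verts w →
           ∃[ w′ ] (Unique (verts {x} {v} w′) × edgs w′ ⊆ edgs w)
  suffix ε       uniq       (here refl) = ε , uniq , λ e → e
  suffix (e ◅ w) uniq       (here refl) = e ◅ w , uniq , λ e → e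
  suffix (e ◅ w) (_ ∷ uniq) (there x∈)  with w′ , uniq′ , sub ← suffix w uniq x∈ = w′ , uniq′ , there ∘ sub

  -- Loop erasure: if the start reappears in the simplified rest, everything before that occurrence
  -- is dropped. Only edges of the original walk survive, so disjointness is inherited.
  simplify : ∀ {u v} (w : Walk G u v) → ∃[ w′ ] (Unique (verts {u} {v} w′) × edgs w′ ⊆ edgs w)
  simplify ε = ε , [] ∷ [] , λ e → e
  simplify {u} (e ◅ w) with w′ , uniq , sub ← simplify w with any? (u ≟_) (verts w′)
  ... | yes u∈ with w″ , uniq″ , sub″ ← suffix w′ uniq u∈ = w″ , uniq″ , there ∘ sub ∘ sub″
  ... | no u∉  = e ◅ w′ , ¬Any⇒All¬ _ u∉ ∷ uniq , λ { (here p) → here p ; (there p) → there (sub p) }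

  All-vertices : ∀ {P : Fin N → Set} {u v} (w : Walk G u v) → P u →
                 All (λ e → P (proj₁ e) × P (proj₂ e)) (edgs w) → All P (verts w)
  All-vertices ε       Pu []              = Pu ∷ []
  All-vertices (_ ◅ w) Pu ((_ , Pv) ∷ Pw) = Pu ∷ All-vertices w Pv Pw

  walk-parity : (c : Fin N → Parity) → (∀ {u v} → Adj G u v → c u ≡ c v ⁻¹) →
                ∀ {u v} (w : Walk G u v) → c u ≡ parity (length (edgs w)) ⊕ c v
  walk-parity c proper ε = refl
  walk-parity c proper {u} {v} (_◅_ {j = x} e w) = begin
    c u                                      ≡⟨ proper e ⟩
    c x ⁻¹                                   ≡⟨ cong _⁻¹ (walk-parity c proper w) ⟩
    (parity (length (edgs w)) ⊕ c v) ⁻¹      ≡⟨ ⁻¹-⊕ (parity (length (edgs w))) ⟩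
    parity (length (edgs w)) ⁻¹ ⊕ c v        ≡⟨ cong (_⊕ c v) (sym (parity-suc (length (edgs w)))) ⟩
    parity (suc (length (edgs w))) ⊕ c v     ∎
    where
    open ≡-Reasoning
    ⁻¹-⊕ : ∀ p {q} → (p ⊕ q) ⁻¹ ≡ p ⁻¹ ⊕ q
    ⁻¹-⊕ 0ℙ = refl
    ⁻¹-⊕ 1ℙ = ℙ.⁻¹-involutive _

  differ⇒odd : (c : Fin N → Parity) → (∀ {u v} → Adj G u v → c u ≡ c v ⁻¹) →
               ∀ {u v} (w : Walk G u v) → c u ≢ c v → parity (length (edgs w)) ≡ 1ℙ
  differ⇒odd c proper w u≢v with parity (length (edgs w)) | walk-parity c proper w
  ... | 0ℙ | u≡v = contradiction u≡v u≢v
  ... | 1ℙ | _   = refl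

≢⇒≡⁻¹ : ∀ {p q : Parity} → p ≢ q → p ≡ q ⁻¹
≢⇒≡⁻¹ {0ℙ} {0ℙ} p≢q = contradiction refl p≢q
≢⇒≡⁻¹ {0ℙ} {1ℙ} _   = refl
≢⇒≡⁻¹ {1ℙ} {0ℙ} _   = refl
≢⇒≡⁻¹ {1ℙ} {1ℙ} p≢q = contradiction refl p≢q

-- Growing a tree one vertex at a time

module Growth {m : ℕ} (T : Graph m) where
  open Walks T

  -- Each new vertex `v` is a leaf, with parent `u`, of the subgraph induced on `v ∷ vs`. Read from
  -- its head, the list is therefore an order in which leaves can be removed one by one.
  data Grown : List (Fin m) → Set where
    root : ∀ r → Grown (r ∷ [])
    grow : ∀ {vs u v} → Grown vs → u ∈ vs → v ∉ vs → Adj T v u →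
           (∀ {w} → w ∈ vs → Adj T v w → w ≡ u) → Grown (v ∷ vs)

  Inside : List (Fin m) → Fin m × Fin m → Set
  Inside vs e = proj₁ e ∈ vs × proj₂ e ∈ vs

  weaken : ∀ {vs v es} → All (Inside vs) es → All (Inside (v ∷ vs)) es
  weaken = All.map λ (p , q) → there p , there q

  connect : ∀ {vs} → Grown vs → ∀ {x y} → x ∈ vs → y ∈ vs →
            ∃[ w ] All (Inside vs) (edgs {x} {y} w)
  connect (root r) (here refl) (here refl) = ε , []
  connect (grow b u∈ v∉ e uniq) (here refl) (here refl) = ε , []
  connect (grow b u∈ v∉ e uniq) (here refl) (there y∈)
    with w , ins ← connect b u∈ y∈ = e ◅ w , (here refl , there u∈) ∷ weaken ins
  connect (grow b u∈ v∉ e uniq) (there x∈) (here refl)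
    with w , ins ← connect b x∈ u∈ =
      w ◅◅ (Graph.sym T e ◅ ε) , All-edges-◅◅ w _ (weaken ins) ((there u∈ , here refl) ∷ [])
  connect (grow b u∈ v∉ e uniq) (there x∈) (there y∈)
    with w , ins ← connect b x∈ y∈ = w , weaken ins

  member : ∀ {vs} → Grown vs → ∃[ x ] x ∈ vs
  member (root r)         = r , here refl
  member (grow _ _ _ _ _) = _ , here refl

  module _ (acyclic : ¬ Cycle T) where

    -- Two distinct neighbours of `v` would be joined by a path inside `vs`; this path misses `v`,
    -- so going through `v` closes it to a cycle.
    unique-neighbour : ∀ {vs u v w} → Grown vs → v ∉ vs → u ∈ vs → w ∈ vs →
                       Adj T v u → Adj T v w → w ≡ u
    unique-neighbour {vs} {u} {v} {w} b v∉ u∈ w∈ vu vw with w ≟ u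
    ... | yes w≡u = w≡u
    ... | no  w≢u with p , ins ← connect b u∈ w∈ with simplify p
    ...   | ε , _ , _ = contradiction refl w≢u
    ...   | q@(_ ◅ _) , uniq , sub = contradiction cycle acyclic
      where
      cycle : Cycle T
      cycle = record
        { path = record
          { walk   = vu ◅ q
          ; simple = All.map (λ x∈ v≡x → v∉ (subst (_∈ vs) (sym v≡x) x∈))
                       (All-vertices q u∈ (anti-mono sub ins)) ∷ uniq
          }
        ; long    = s≤s (s≤s z≤n)
        ; closing = Graph.sym T vw
        }

    grow-along : ∀ {vs x y} → Grown vs → x ∈ vs → Walk T x y →
                 ∃[ ws ] (Grown ws × vs ⊆ ws × y ∈ ws)
    grow-along b x∈ ε = _ , b , (λ p → p) , x∈
    grow-along {vs} b x∈ (_◅_ {j = z} e w) with any? (z ≟_) vs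
    ... | yes z∈ = grow-along b z∈ w
    ... | no  z∉ with ws , b′ , sub , y∈ ← grow-along
                        (grow b x∈ z∉ (Graph.sym T e) λ w∈ zw → unique-neighbour b z∉ x∈ w∈ (Graph.sym T e) zw)
                        (here refl) w
                 = ws , b′ , sub ∘ there , y∈

    grow-to-all : Connected T → Fin m → ∀ ys → ∃[ ws ] (Grown ws × (∀ {y} → y ∈ ys → y ∈ ws))
    grow-to-all conn r [] = _ , root r , λ ()
    grow-to-all conn r (y ∷ ys) with vs , b , covers ← grow-to-all conn r ys
      with ws , b′ , sub , y∈ ← grow-along b (proj₂ (member b)) (conn _ y)
      = ws , b′ , λ { (here refl) → y∈ ; (there p) → sub (covers p) }

  Grown-spanning : IsTree T → ∃[ vs ] (Grown vs × (∀ v → v ∈ vs))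
  Grown-spanning (1≤m , conn , acyclic) with vs , b , covers ← grow-to-all acyclic conn (fromℕ< 1≤m) (allFin m)
    = vs , b , λ v → covers (∈-allFin v)

  assign : Fin m → Parity → (Fin m → Parity) → Fin m → Parity
  assign v p c = updateAt c v (const p)

  assign-new : ∀ v p c → assign v p c v ≡ p
  assign-new v p c = updateAt-updates v c

  assign-old : ∀ {vs v} p c → v ∉ vs → ∀ {w} → w ∈ vs → assign v p c w ≡ c w
  assign-old {vs} {v} p c v∉ {w} w∈ = updateAt-minimal w v c λ { refl → v∉ w∈ }

  -- A new vertex has only its parent as an earlier neighbour, so the opposite of the parent's
  -- colour is always available.
  colouring : ∀ {vs} → Grown vs →
              ∃[ c ] (∀ {x y} → x ∈ vs → y ∈ vs → Adj T x y → c x ≡ c y ⁻¹)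
  colouring (root r) = const 0ℙ , λ { (here refl) (here refl) e → contradiction e (Graph.irrefl T refl) }
  colouring {v ∷ vs} (grow {u = u} b u∈ v∉ _ uniq) with c , proper ← colouring b = c′ , proper′
    where
    c′ = assign v (c u ⁻¹) c

    at-v : ∀ {y} → y ∈ vs → Adj T v y → c′ v ≡ c′ y ⁻¹
    at-v {y} y∈ e with refl ← uniq y∈ e =
      trans (assign-new v _ c) (cong _⁻¹ (sym (assign-old _ c v∉ y∈)))

    proper′ : ∀ {x y} → x ∈ v ∷ vs → y ∈ v ∷ vs → Adj T x y → c′ x ≡ c′ y ⁻¹
    proper′ (here refl) (here refl) e = contradiction e (Graph.irrefl T refl)
    proper′ (here refl) (there y∈)  e = at-v y∈ e
    proper′ (there x∈)  (here refl) e = trans (sym (ℙ.⁻¹-involutive _)) (cong _⁻¹ (sym (at-v x∈ (Graph.sym T e))))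
    proper′ (there x∈)  (there y∈)  e =
      trans (assign-old _ c v∉ x∈) (trans (proper x∈ y∈ e) (cong _⁻¹ (sym (assign-old _ c v∉ y∈))))

-- Pairing partial paths

module Pairing {m : ℕ} (G : Graph (suc m)) (h : Fin (suc m)) (c : Fin m → Parity)
               (proper : ∀ {u v} → Adj (G -ᵥ h) u v → c u ≡ c v ⁻¹) where

  T : Graph m
  T = G -ᵥ h

  open Walks T
  open Growth T

  Edge : Set
  Edge = Fin (suc m) × Fin (suc m)

  embed : Fin m × Fin m → Edge
  embed (u , v) = punchIn h u , punchIn h v

  Neighbour : Fin m → Set
  Neighbour v = Adj G h (punchIn h v)

  -- A path that starts at a neighbour of h and awaits a partner at its current
  -- vertex; `last` is the last edge of the walk preceded by the edge from h.
  record Partial : Set where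
    field
      origin current : Fin m
      neighbour      : Neighbour origin
      walk           : Walk T origin current
      last           : Edge
      last-adj       : Adj G (proj₁ last) (proj₂ last)

    -- The class of the origin is also the side that the partial path demands of its current vertex.
    colour : Parity
    colour = c origin

  open Partial

  -- The vertices claimed as endpoints and the edges of `T` that are used. A partial path claims its
  -- origin only, since its current vertex need not become an endpoint.
  Footprint : Set
  Footprint = List (Fin m) × List (Fin m × Fin m)

  partialPrint : Partial → Footprint
  partialPrint p = origin p ∷ [] , edgs (walk p)

  pathPrint : Path T → Footprint
  pathPrint P = Path.start P ∷ Path.end P ∷ [] , pathEdges P

  Compatible : Footprint → Footprint → Set
  Compatible (as , es) (bs , fs) = Avoid _≡_ as bs × Avoid SameEdge es fs

  Compatible-sym : Symmetric Compatible
  Compatible-sym (as# , es#) = Avoid-sym sym as# , Avoid-sym SameEdge-sym es#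

  -- An edge with just one end in `vs` counts as outside: this is what becomes of the edge from a
  -- removed leaf to its parent.
  Outside : List (Fin m) → Fin m × Fin m → Set
  Outside vs e = ¬ Inside vs e

  Outside-shrink : ∀ {vs v es} → All (Outside (v ∷ vs)) es → All (Outside vs) es
  Outside-shrink = All.map λ out (p , q) → out (there p , there q)

  Outside-flip : ∀ {vs} → ClosedUnderFlip (Outside vs)
  Outside-flip out (p , q) = out (q , p)

  Avoiding-flip : ∀ {fs} → ClosedUnderFlip {m} (λ e → All (λ f → ¬ SameEdge e f) fs)
  Avoiding-flip = All.map (_∘ SameEdge-flip)

  Outside⇒≁ : ∀ {vs e f} → Inside vs e → Outside vs f → ¬ SameEdge e f
  Outside⇒≁ ins out (inj₁ (refl , refl)) = out ins
  Outside⇒≁ (p , q) out (inj₂ (refl , refl)) = out (q , p)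

  record Closed (P : Path T) : Set where
    field
      odd            : OddPath P
      joinNeighbours : Neighbour (Path.start P) × Neighbour (Path.end P)

  record Admissible (vs : List (Fin m)) (L : List Partial) : Set where
    field
      current∈   : All (λ p → current p ∈ vs) L
      outside    : All (λ p → All (Outside vs) (edgs (walk p))) L
      compatible : AllPairs (λ p q → Compatible (partialPrint p) (partialPrint q)) L

  -- `side` says on which side of the cut between the two classes of neighbours
  -- of h each vertex lies; `cut` contains all edges that cross it.
  record Solution (vs : List (Fin m)) (L : List Partial) : Set where
    field
      paths     : List (Path T)
      cut       : List Edge
      side      : Fin m → Parity
      count     : length cut ≡ length paths
      closed    : All Closed paths
      cut-adj   : All (λ e → Adj G (proj₁ e) (proj₂ e)) cut
      disjoint  : AllPairs (λ P Q → Compatible (pathPrint P) (pathPrint Q)) paths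
      -- The paths are assembled from the partial paths in `L` and edges within `vs`, with origins
      -- from `L` as endpoints, so whatever avoids these avoids the paths. The footprint `Q` is
      -- arbitrary so that the property passes through the recursion and applies to every path added
      -- later.
      confined  : ∀ {Q} → All (Outside vs) (proj₂ Q) → All (λ p → Compatible (partialPrint p) Q) L →
                  All (λ P → Compatible (pathPrint P) Q) paths
      separates : ∀ {x y} → x ∈ vs → y ∈ vs → Adj T x y →
                  side x ≡ side y ⊎ Any (SameEdge (embed (x , y))) cut
      satisfies : All (λ p → side (current p) ≡ colour p ⊎ Any (SameEdge (last p)) cut) L

  -- Resolving conflicts between partial paths

  Conflict : Partial → Partial → Set
  Conflict p q = current p ≡ current q × colour p ≢ colour q

  conflict? : ∀ p q → Dec (Conflict p q)
  conflict? p q = (current p ≟ current q) ×-dec ¬? (colour p ℙ.≟ colour q)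

  ConflictFree : List Partial → Set
  ConflictFree = AllPairs (λ p q → ¬ Conflict p q)

  no-conflict⇒≡ : ∀ {p q} → ¬ Conflict p q → current p ≡ current q → colour p ≡ colour q
  no-conflict⇒≡ ¬conf cur = decidable-stable (_ ℙ.≟ _) (λ ≢ → ¬conf (cur , ≢))

  -- The ends of the joined path are the two origins; they lie in different classes, which makes it
  -- odd. Since loop erasure adds no edges, whatever avoids both walks avoids the path.
  join : ∀ {p q} → Conflict p q →
         ∃[ P ] (Closed P
               × (∀ {Q} → Compatible (partialPrint p) Q → Compatible (partialPrint q) Q →
                    Compatible (pathPrint P) Q)
               × (∀ {vs} → All (Outside vs) (edgs (walk p)) → All (Outside vs) (edgs (walk q)) →
                    All (Outside vs) (pathEdges P)))
  join {p} {q} (refl , p≢q) with w , uniq , sub ← simplify (walk p ◅◅ rev (walk q)) =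
    record { walk = w ; simple = uniq } ,
    record { odd = differ⇒odd c proper w p≢q ; joinNeighbours = neighbour p , neighbour q } ,
    (λ { (a# ∷ [] , es#) (b# ∷ [] , fs#) → a# ∷ b# ∷ [] , joined Avoiding-flip es# fs# }) ,
    joined Outside-flip
    where
    joined : ∀ {P : Fin m × Fin m → Set} → ClosedUnderFlip P →
             All P (edgs (walk p)) → All P (edgs (walk q)) → All P (edgs w)
    joined flip Pp Pq = anti-mono sub (All-edges-◅◅ (walk p) _ Pp (All-edges-rev flip (walk q) Pq))

  -- Whichever side the common vertex of a conflicting pair ends up on, exactly
  -- one of the two last edges has to be cut, so the pair pays for its path.
  resolve : ∀ {vs p q L} → Conflict p q → Admissible vs (p ∷ q ∷ L) → Solution vs L → Solution vs (p ∷ q ∷ L)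
  resolve {vs} {p} {q} {L} conf@(refl , p≢q) adm S with P , closedP , unionP , outsideP ← join {p} {q} conf
    with (p#q ∷ p#L) ∷ (q#L ∷ _) ← Admissible.compatible adm
    with pOut ∷ qOut ∷ _ ← Admissible.outside adm
    = record
    { paths     = P ∷ paths
    ; cut       = violated ∷ cut
    ; side      = side
    ; count     = cong suc count
    ; closed    = closedP ∷ closed
    ; cut-adj   = violated-adj ∷ cut-adj
    -- Here `confined` is applied to the footprint of `P` itself: its edges lie outside `vs`, and
    -- the other partial paths are compatible with both `p` and `q`.
    ; disjoint  = All.map Compatible-sym
                    (confined (outsideP pOut qOut)
                      (All.zipWith (λ (p# , q#) → Compatible-sym (unionP p# q#)) (p#L , q#L)))
                  ∷ disjoint
    ; confined  = λ { out (p# ∷ q# ∷ L#) → unionP p# q# ∷ confined out L# }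
    ; separates = λ x∈ y∈ e → Sum.map₂ there (separates x∈ y∈ e)
    ; satisfies = violated-p ∷ violated-q ∷ All.map (Sum.map₂ there) satisfies
    }
    where
    open Solution S

    choice : ∃[ e ] (Adj G (proj₁ e) (proj₂ e) ×
                     (side (current p) ≡ colour p ⊎ SameEdge (last p) e) ×
                     (side (current p) ≡ colour q ⊎ SameEdge (last q) e))
    choice with side (current p) ℙ.≟ colour p
    ... | yes s≡p = last q , last-adj q , inj₁ s≡p , inj₂ SameEdge-refl
    ... | no  s≢p = last p , last-adj p , inj₂ SameEdge-refl ,
                    inj₁ (trans (≢⇒≡⁻¹ s≢p) (trans (cong _⁻¹ (≢⇒≡⁻¹ p≢q)) (ℙ.⁻¹-involutive _)))

    violated = proj₁ choice
    violated-adj = proj₁ (proj₂ choice)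
    violated-p = Sum.map₂ here (proj₁ (proj₂ (proj₂ choice)))
    violated-q = Sum.map₂ here (proj₂ (proj₂ (proj₂ choice)))

  Admissible-resp-↭ : ∀ {vs L L′} → L ↭ L′ → Admissible vs L → Admissible vs L′
  Admissible-resp-↭ σ adm = record
    { current∈   = All-resp-↭ σ current∈
    ; outside    = All-resp-↭ σ outside
    ; compatible = AllPairs-resp-↭ Compatible-sym σ compatible
    }
    where open Admissible adm

  Solution-resp-↭ : ∀ {vs L L′} → L ↭ L′ → Solution vs L → Solution vs L′
  Solution-resp-↭ σ S = record
    { paths = paths ; cut = cut ; side = side ; count = count ; closed = closed
    ; cut-adj = cut-adj ; disjoint = disjoint ; separates = separates
    ; confined  = λ out L# → confined out (All-resp-↭ (↭-sym σ) L#)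
    ; satisfies = All-resp-↭ σ satisfies
    }
    where open Solution S

  Admissible-tail : ∀ {vs p L} → Admissible vs (p ∷ L) → Admissible vs L
  Admissible-tail adm = record
    { current∈   = All.tail current∈
    ; outside    = All.tail outside
    ; compatible = AllPairs.tail compatible
    }
    where open Admissible adm

  -- Each resolved conflict removes two partial paths, until a conflict-free list is left for
  -- `base`. The bound `n` on the length serves termination.
  resolve-all : ∀ {vs} → (∀ {L} → Admissible vs L → ConflictFree L → Solution vs L) →
                ∀ n {L} → length L ≤ n → Admissible vs L → Solution vs L
  resolve-all base n {L} len adm with pair-or-none conflict? L
  ... | inj₂ free = base adm free
  ... | inj₁ (p , q , L′ , σ , conf) with n | subst (_≤ n) (↭-length σ) len
  ...   | suc n′ | s≤s len′ =
    Solution-resp-↭ (↭-sym σ)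
      (resolve conf adm′
        (resolve-all base n′ (≤-trans (n≤1+n _) len′) (Admissible-tail (Admissible-tail adm′))))
    where adm′ = Admissible-resp-↭ σ adm

  -- Conflict-free partial paths at the root and at a leaf

  solve-root : ∀ {r L} → Admissible (r ∷ []) L → ConflictFree L → Solution (r ∷ []) L
  solve-root {r} {L} adm free = record
    { paths = [] ; cut = [] ; side = const (common L) ; count = refl ; closed = [] ; cut-adj = []
    ; disjoint = [] ; confined = λ _ _ → []
    ; separates = λ _ _ _ → inj₁ refl
    ; satisfies = All.map inj₁ (agrees (Admissible.current∈ adm) free)
    }
    where
    common : List Partial → Parity
    -- With no partial path there is no demand, and either side would do.
    common []      = 0ℙ
    common (p ∷ _) = colour p

    agrees : ∀ {L} → All (λ p → current p ∈ r ∷ []) L → ConflictFree L → All (λ p → common L ≡ colour p) L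
    agrees [] [] = []
    agrees {p ∷ L} (here refl ∷ cur) (p-free ∷ _) =
      refl ∷ All.zipWith (λ { {q} (here refl , ¬conf) → no-conflict⇒≡ {p} {q} ¬conf refl }) (cur , p-free)

  module Leaf {vs u v} (u∈ : u ∈ vs) (v∉ : v ∉ vs) (vu : Adj T v u)
              (uniq : ∀ {w} → w ∈ vs → Adj T v w → w ≡ u) where

    -- The leaf takes the side `s`, which is what every partial path waiting there demands; the
    -- remaining ones are satisfied by `S` already. The leaf edge adds nothing to the cut: either it
    -- does not cross or `S` cuts it.
    extend-solution : ∀ {L L′} (S : Solution vs L′) (s : Parity) →
      s ≡ Solution.side S u ⊎ Any (SameEdge (embed (v , u))) (Solution.cut S) →
      (∀ {p} → p ∈ L → current p ∈ v ∷ vs) →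
      (∀ {p} → p ∈ L → current p ≡ v → s ≡ colour p) →
      (∀ {p} → p ∈ L → current p ≢ v → p ∈ L′) →
      (∀ {Q} → All (Outside (v ∷ vs)) (proj₂ Q) → All (λ p → Compatible (partialPrint p) Q) L →
        All (λ p → Compatible (partialPrint p) Q) L′) →
      Solution (v ∷ vs) L
    extend-solution {L} S s edge cur∈ at-v away transfer = record
      { paths = paths ; cut = cut ; side = side′ ; count = count ; closed = closed
      ; cut-adj = cut-adj ; disjoint = disjoint
      ; confined  = λ out L# → confined (Outside-shrink out) (transfer out L#)
      ; separates = separates′
      ; satisfies = All.tabulate satisfies′
      }
      where
      open Solution S
      side′ = assign v s side

      new : side′ v ≡ s
      new = assign-new v s side

      old : ∀ {x} → x ∈ vs → side′ x ≡ side x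
      old = assign-old s side v∉

      leaf-edge : ∀ {y} → y ∈ vs → Adj T v y → side′ v ≡ side′ y ⊎ Any (SameEdge (embed (v , y))) cut
      leaf-edge y∈ e with refl ← uniq y∈ e = Sum.map₁ (λ eq → trans new (trans eq (sym (old y∈)))) edge

      separates′ : ∀ {x y} → x ∈ v ∷ vs → y ∈ v ∷ vs → Adj T x y →
                   side′ x ≡ side′ y ⊎ Any (SameEdge (embed (x , y))) cut
      separates′ (here refl) (here refl) e = inj₁ refl
      separates′ (here refl) (there y∈)  e = leaf-edge y∈ e
      separates′ (there x∈)  (here refl) e = Sum.map sym (Any.map SameEdge-flip) (leaf-edge x∈ (Graph.sym T e))
      separates′ (there x∈)  (there y∈)  e =
        Sum.map₁ (λ eq → trans (old x∈) (trans eq (sym (old y∈)))) (separates x∈ y∈ e)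

      satisfies′ : ∀ {p} → p ∈ L → side′ (current p) ≡ colour p ⊎ Any (SameEdge (last p)) cut
      satisfies′ {p} p∈ with current p ≟ v
      ... | yes refl = inj₁ (trans new (at-v p∈ refl))
      ... | no  ≢v with cur∈ p∈
      ...   | here ≡v   = contradiction ≡v ≢v
      ...   | there ∈vs = Sum.map₁ (trans (old ∈vs)) (All.lookup satisfies (away p∈ ≢v))

    -- Making the leaf edge the last edge turns the demand of the pushed path into the statement
    -- needed for the leaf: the parent is on side `colour p`, or the leaf edge is cut.
    push : (p : Partial) → current p ≡ v → Partial
    push p p-at = record
      { origin = origin p ; current = u ; neighbour = neighbour p
      ; walk = walk p ◅◅ (subst (λ x → Adj T x u) (sym p-at) vu ◅ ε) ; last = embed (v , u) ; last-adj = vu }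

    push-compatible : ∀ p (p-at : current p ≡ v) {Q} → All (Outside (v ∷ vs)) (proj₂ Q) →
                      Compatible (partialPrint p) Q → Compatible (partialPrint (push p p-at)) Q
    push-compatible p p-at out (a# , es#) =
      a# , All-edges-◅◅ (walk p) _ es# (All.map (Outside⇒≁ (here p-at , there u∈)) out ∷ [])

    push-outside : ∀ p (p-at : current p ≡ v) → All (Outside (v ∷ vs)) (edgs (walk p)) →
                   All (Outside vs) (edgs (walk (push p p-at)))
    push-outside p p-at out =
      All-edges-◅◅ (walk p) _ (Outside-shrink out) ((λ (v∈ , _) → v∉ (subst (_∈ vs) p-at v∈)) ∷ [])

    solve-leaf : (∀ {L} → Admissible vs L → Solution vs L) →
                 ∀ {L} → Admissible (v ∷ vs) L → ConflictFree L → Solution (v ∷ vs) L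
    solve-leaf solve {L} adm free with any? (λ p → current p ≟ v) L
    -- Nothing waits at the leaf, so it copies the side of its parent.
    ... | no none = extend-solution S (Solution.side S u) (inj₁ refl)
                      (All.lookup current∈)
                      (λ p∈ p-at → contradiction (lose p∈ p-at) none)
                      (λ p∈ _ → p∈)
                      (λ _ L# → L#)
      where
      open Admissible adm
      S : Solution vs L
      S = solve record
        { current∈ = All.zipWith (λ { (here ≡v , ≢v) → contradiction ≡v ≢v ; (there ∈vs , _) → ∈vs })
                       (current∈ , ¬Any⇒All¬ L none)
        ; outside = All.map Outside-shrink outside
        ; compatible = compatible
        }
    -- Without conflicts all partial paths at the leaf have the colour of `p`. Only one can use the
    -- leaf edge, so `p` is pushed and the others are given up; the side `colour p` satisfies them
    -- all.
    ... | yes some with p , p∈ , p-at ← find some =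
      extend-solution S (colour p) edge
        (All.lookup current∈)
        (λ {q} q∈ q-at → Sum.[ cong colour , (λ ¬conf → no-conflict⇒≡ {p} {q} ¬conf (trans p-at (sym q-at))) ]
           (AllPairs-lookup (λ ¬conf (eq , ≢) → ¬conf (sym eq , ≢-sym ≢)) free p∈ q∈))
        (λ q∈ q≢v → there (∈-filter⁺ away? q∈ q≢v))
        (λ out L# → push-compatible p p-at out (All.lookup L# p∈) ∷ All.filter⁺ away? L#)
      where
      open Admissible adm
      away? = λ q → ¬? (current q ≟ v)
      rest = filter away? L

      compatible-rest : ∀ {q} → q ∈ rest → Compatible (partialPrint p) (partialPrint q)
      compatible-rest q∈rest with q∈ , q≢v ← ∈-filter⁻ away? q∈rest
        with AllPairs-lookup Compatible-sym compatible p∈ q∈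
      ... | inj₁ refl = contradiction p-at q≢v
      ... | inj₂ comp = comp

      adm′ : Admissible vs (push p p-at ∷ rest)
      adm′ = record
        { current∈ = u∈ ∷ All.tabulate current-rest
        ; outside = push-outside p p-at (All.lookup outside p∈)
                    ∷ All.map Outside-shrink (All.filter⁺ away? outside)
        ; compatible = All.tabulate (λ q∈rest → push-compatible p p-at
                          (All.lookup outside (proj₁ (∈-filter⁻ away? q∈rest))) (compatible-rest q∈rest))
                       ∷ AllPairs.filter⁺ away? compatible
        }
        where
        current-rest : ∀ {q} → q ∈ rest → current q ∈ vs
        current-rest q∈rest with q∈ , q≢v ← ∈-filter⁻ away? q∈rest with All.lookup current∈ q∈
        ... | here ≡v   = contradiction ≡v q≢v
        ... | there ∈vs = ∈vs

      S : Solution vs (push p p-at ∷ rest)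
      S = solve adm′

      edge : colour p ≡ Solution.side S u ⊎ Any (SameEdge (embed (v , u))) (Solution.cut S)
      edge = Sum.map₁ sym (All.head (Solution.satisfies S))

  solve : ∀ {vs} → Grown vs → ∀ {L} → Admissible vs L → Solution vs L
  solve (root r) = resolve-all solve-root _ ≤-refl
  solve (grow b u∈ v∉ vu uniq) = resolve-all (Leaf.solve-leaf u∈ v∉ vu uniq (solve b)) _ ≤-refl

-- All-negative graphs with some edges deleted

module Deletion {N : ℕ} (G : Graph N) (F : List (Fin N × Fin N)) where

  Remaining : Graph N
  Remaining = G ∖ F

  open Walks Remaining

  Signed : SignedGraph N
  Signed = deleteEdges (allNegative G) F

  toSign-suc : ∀ n → Sign.- Sign.* toSign (parity n) ≡ toSign (parity (suc n))
  toSign-suc n = trans (sym (ℙ.+-homo-* 1ℙ (parity n))) (cong toSign (sym (parity-suc n)))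

  walkSign-parity : ∀ {u v} (w : Walk Remaining u v) → walkSign Signed w ≡ toSign (parity (length (edgs w)))
  walkSign-parity ε       = refl
  walkSign-parity (_ ◅ w) = trans (cong (Sign.- Sign.*_) (walkSign-parity w)) (toSign-suc (length (edgs w)))

  cycleSign-parity : ∀ C → cycleSign Signed C ≡ toSign (parity (suc (edgeCount (Cycle.path C))))
  cycleSign-parity C =
    trans (cong (Sign.- Sign.*_) (walkSign-parity (Path.walk path))) (toSign-suc (edgeCount path))
    where open Cycle C

  -- The closing edge of a cycle joins different colours, so the rest of the cycle is odd and its
  -- total length even; an even number of negative signs has positive product.
  colourable⇒balanced : (y : Fin N → Parity) →
    (∀ u v → Adj G u v → y u ≡ y v ⁻¹ ⊎ Any (SameEdge (u , v)) F) → Balanced Signed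
  colourable⇒balanced y cover C = trans (cycleSign-parity C)
    (cong toSign (trans (parity-suc (edgeCount path)) (cong _⁻¹ odd)))
    where
    open Cycle C
    proper : ∀ {u v} → Adj Remaining u v → y u ≡ y v ⁻¹
    proper {u} {v} (e , e∉F) with cover u v e
    ... | inj₁ eq  = eq
    ... | inj₂ e∈F = contradiction e∈F e∉F
    odd : parity (edgeCount path) ≡ 1ℙ
    odd = differ⇒odd y proper (Path.walk path) λ eq →
      ℙ.p≢p⁻¹ _ (trans eq (proper closing))

-- The min-max equality for an apex tree

module Apex {n} (A : ApexTree n) where

  open ApexTree A
  open Walks T using (edgs; verts)

  spanning = Growth.Grown-spanning T isTree

  colours : ∃[ c ] (∀ {u v} → Adj T u v → c u ≡ c v ⁻¹)
  colours with c , proper ← Growth.colouring T (proj₁ (proj₂ spanning))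
    = c , proper (proj₂ (proj₂ spanning) _) (proj₂ (proj₂ spanning) _)

  c : Fin m → Parity
  c = proj₁ colours

  open Pairing graph h c (proj₂ colours) hiding (T)

  -- Weak duality

  cycleEdges : Path T → List Edge
  cycleEdges P = (h , punchIn h (Path.start P)) ∷ (punchIn h (Path.end P) , h) ∷ map embed (pathEdges P)

  embed-reflects : ∀ {e f} → SameEdge (embed e) (embed f) → SameEdge e f
  embed-reflects = Sum.map both both
    where
    both : ∀ {a b c d} → punchIn h a ≡ punchIn h b × punchIn h c ≡ punchIn h d → a ≡ b × c ≡ d
    both (p , q) = punchIn-injective h _ _ p , punchIn-injective h _ _ q

  data CycleEdge (P : Path T) (e : Edge) : Set where
    spoke : ∀ {x} → IsEndpoint x P → SameEdge e (h , punchIn h x) → CycleEdge P e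
    rim   : ∀ {f} → f ∈ pathEdges P → SameEdge e (embed f) → CycleEdge P e

  cycleEdge : ∀ {P e} → Any (SameEdge e) (cycleEdges P) → CycleEdge P e
  cycleEdge (here e~)          = spoke (inj₁ refl) e~
  cycleEdge (there (here e~))  = spoke (inj₂ refl) (SameEdge-trans e~ (inj₂ (refl , refl)))
  cycleEdge {P} (there (there i)) with _ , f∈ , e~ ← find (Any.map⁻ i) = rim f∈ e~

  spoke≁rim : ∀ {x f} → ¬ SameEdge (h , punchIn h x) (embed f)
  spoke≁rim (inj₁ (p , _)) = punchInᵢ≢i h _ (sym p)
  spoke≁rim (inj₂ (p , _)) = punchInᵢ≢i h _ (sym p)

  spoke-injective : ∀ {x y} → SameEdge (h , punchIn h x) (h , punchIn h y) → x ≡ y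
  spoke-injective (inj₁ (_ , p)) = punchIn-injective h _ _ p
  spoke-injective (inj₂ (p , _)) = contradiction (sym p) (punchInᵢ≢i h _)

  -- Disjoint endpoints separate the edges at `h`, disjoint edges separate those in `T`, and no edge
  -- is of both kinds.
  cycles-disjoint : ∀ {P Q} → EdgeDisjoint P Q → EndpointDisjoint P Q →
                    ∀ e → Any (SameEdge e) (cycleEdges P) → ¬ Any (SameEdge e) (cycleEdges Q)
  cycles-disjoint {P} {Q} edge# end# e i j with cycleEdge {P} i | cycleEdge {Q} j
  ... | spoke x∈P e~ | spoke y∈Q e~′ = end# x∈P
        (subst (λ z → IsEndpoint z Q) (sym (spoke-injective (SameEdge-trans (SameEdge-sym e~) e~′))) y∈Q)
  ... | spoke _ e~   | rim _ e~′   = spoke≁rim (SameEdge-trans (SameEdge-sym e~) e~′)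
  ... | rim _ e~     | spoke _ e~′ = spoke≁rim (SameEdge-trans (SameEdge-sym e~′) e~)
  ... | rim f∈P e~   | rim g∈Q e~′ = edge# f∈P g∈Q (embed-reflects (SameEdge-trans (SameEdge-sym e~) e~′))

  module _ (F : List Edge) where
    open Deletion graph F
    open Walks Remaining using () renaming (edgs to edgsʳ; verts to vertsʳ)

    lift : ∀ {u v} (w : Walk T u v) → All (λ e → ¬ Any (SameEdge (embed e)) F) (edgs w) →
           ∃[ w′ ] (vertsʳ {punchIn h u} {punchIn h v} w′ ≡ map (punchIn h) (verts w)
                    × length (edgsʳ w′) ≡ length (edgs w))
    lift ε [] = ε , refl , refl
    lift (e ◅ w) (e∉ ∷ w∉) with w′ , vs≡ , len≡ ← lift w w∉ = (e , e∉) ◅ w′ , cong (_ ∷_) vs≡ , cong suc len≡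

    -- Closed up through `h`, the path becomes a cycle of odd length, hence a negative one. If `F`
    -- missed it, it would survive the deletion.
    hit : Balanced Signed → ∀ {P} → Closed P → Any (λ e → Any (SameEdge e) (cycleEdges P)) F
    hit balanced {P} closedP with any? (λ e → any? (sameEdge? e) (cycleEdges P)) F
    ... | yes found = found
    ... | no none = contradiction
          (trans (sym (balanced cycle)) (trans (cycleSign-parity cycle) (cong toSign odd-cycle))) λ ()
      where
      open Closed closedP
      open Path P using (walk; simple)
      missed : All (λ f → ¬ Any (SameEdge f) F) (cycleEdges P)
      missed = All.tabulate λ f∈ f∈F → none (Any.map (λ f~e → lose f∈ (SameEdge-sym f~e)) f∈F)

      lifted = lift walk (All.map⁻ (All.tail (All.tail missed)))
      w′ = proj₁ lifted

      cycle : Cycle Remaining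
      cycle = record
        { path = record
          { walk   = (proj₁ joinNeighbours , All.head missed) ◅ w′
          ; simple = subst Unique (cong (h ∷_) (sym (proj₁ (proj₂ lifted))))
                       (All.map⁺ (All.tabulate λ _ → ≢-sym (punchInᵢ≢i h _)) ∷
                        map⁺ (λ {x} {y} → punchIn-injective h x y) simple)
          }
        ; long    = s≤s (subst (1 ≤_) (sym (proj₂ (proj₂ lifted))) (odd⇒≥1 (edgeCount P) odd))
        ; closing = Graph.sym graph (proj₂ joinNeighbours) , All.head (All.tail missed)
        }
        where
        odd⇒≥1 : ∀ k → parity k ≡ 1ℙ → 1 ≤ k
        odd⇒≥1 (suc _) _ = s≤s z≤n

      odd-cycle : parity (suc (edgeCount (Cycle.path cycle))) ≡ 1ℙ
      -- The two edges at `h` disappear by computation, since `parity` recurses in steps of two.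
      odd-cycle = trans (cong parity (proj₂ (proj₂ lifted))) odd

  weak-duality : ∀ {j k} → BalancedByDeleting (allNegative graph) j → HasOddPathPacking A k → k ≤ j
  weak-duality (F , _ , refl , balanced) (Ps , packing , refl) =
    length-≤-by-hitting
      (AllPairs.zipWith {R = EdgeDisjoint} {S = EndpointDisjoint}
        (λ {P} {Q} # → cycles-disjoint {P} {Q} (proj₁ #) (proj₂ #)) (edgeDisjoint , endpointDisjoint))
      (All.zipWith (λ {P} (o , j) → hit F balanced {P} record { odd = o ; joinNeighbours = j }) (odd , joinNeighbours))
    where open IsOddPathPacking packing

  -- Strong duality

  -- With the edge from `h` as last edge, satisfying this partial path means that `a` is on the side
  -- of its own class or that this edge is cut.
  trivial : ∀ {a} → Neighbour a → Partial
  trivial {a} nbr = record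
    { origin = a ; current = a ; neighbour = nbr ; walk = ε
    ; last = h , punchIn h a ; last-adj = nbr }

  trivials : ∀ {as} → All Neighbour as → List Partial
  trivials = All.reduce trivial

  trivial∈ : ∀ {as a} (nbrs : All Neighbour as) → a ∈ as →
             ∃[ nbr ] trivial {a} nbr ∈ trivials nbrs
  trivial∈ (nbr ∷ _)  (here refl) = nbr , here refl
  trivial∈ (_ ∷ nbrs) (there a∈) with nbr , t∈ ← trivial∈ nbrs a∈ = nbr , there t∈

  All-trivials : ∀ {P : Partial → Set} {Q : Fin m → Set} →
                 (∀ {a} (nbr : Neighbour a) → Q a → P (trivial nbr)) →
                 ∀ {as} (nbrs : All Neighbour as) → All Q as → All P (trivials nbrs)
  All-trivials f []           []       = []
  All-trivials f (nbr ∷ nbrs) (q ∷ qs) = f nbr q ∷ All-trivials f nbrs qs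

  trivials-compatible : ∀ {as} (nbrs : All Neighbour as) → Unique as →
    AllPairs (λ p q → Compatible (partialPrint p) (partialPrint q)) (trivials nbrs)
  trivials-compatible [] [] = []
  trivials-compatible (_ ∷ nbrs) (a# ∷ uniq) =
    All-trivials (λ _ a≢b → ((a≢b ∷ []) ∷ []) , []) nbrs a# ∷ trivials-compatible nbrs uniq

  neighbour? = λ v → Graph.adj? graph h (punchIn h v)

  neighbours = filter neighbour? (allFin m)

  neighbours-adj : All Neighbour neighbours
  neighbours-adj = All.all-filter neighbour? (allFin m)

  solution : Solution (proj₁ spanning) (trivials neighbours-adj)
  solution = solve (proj₁ (proj₂ spanning)) record
    { current∈   = All-trivials (λ _ a∈ → a∈) neighbours-adj (All.tabulate λ _ → proj₂ (proj₂ spanning) _)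
    ; outside    = All-trivials {Q = λ _ → ⊤} (λ _ _ → []) neighbours-adj (All.tabulate λ _ → _)
    ; compatible = trivials-compatible neighbours-adj (AllPairs.filter⁺ neighbour? (allFin⁺ m))
    }

  open Solution solution

  packing : IsOddPathPacking A paths
  packing = record
    { odd = All.map Closed.odd closed
    ; joinNeighbours = All.map Closed.joinNeighbours closed
    ; edgeDisjoint = AllPairs.map (λ {P} {Q} → edge# {P} {Q}) disjoint
    ; endpointDisjoint = AllPairs.map (λ {P} {Q} → endpoint# {P} {Q}) disjoint
    }
    where
    endpoint : ∀ {P : Path T} {x} → IsEndpoint x P → x ∈ Path.start P ∷ Path.end P ∷ []
    endpoint (inj₁ p) = here p
    endpoint (inj₂ p) = there (here p)
    edge# : ∀ {P Q} → Compatible (pathPrint P) (pathPrint Q) → EdgeDisjoint P Q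
    edge# (_ , es#) e∈ f∈ = All.lookup (All.lookup es# e∈) f∈
    endpoint# : ∀ {P Q} → Compatible (pathPrint P) (pathPrint Q) → EndpointDisjoint P Q
    endpoint# {P} {Q} (as# , _) x∈P x∈Q =
      All.lookup (All.lookup as# (endpoint {P} x∈P)) (endpoint {Q} x∈Q) refl

  -- Sides are colours relative to the bipartition `c`, so adding `c` recovers the colours
  -- themselves. A neighbour of `h` on the side of its own class gets `c v ⊕ c v`, which is `0ℙ`;
  -- hence the value `1ℙ` at `h`.
  two-colouring : Fin (suc m) → Parity
  two-colouring = insertAt (λ v → c v ⊕ side v) h 1ℙ

  at-apex : two-colouring h ≡ 1ℙ
  at-apex = insertAt-lookup _ h 1ℙ

  at-tree : ∀ v → two-colouring (punchIn h v) ≡ c v ⊕ side v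
  at-tree = insertAt-punchIn _ h 1ℙ

  apex-or-tree : ∀ u → u ≡ h ⊎ ∃[ v ] u ≡ punchIn h v
  apex-or-tree u with h ≟ u
  ... | yes h≡u = inj₁ (sym h≡u)
  ... | no  h≢u = inj₂ (punchOut h≢u , sym (punchIn-punchOut h≢u))

  apex-cover : ∀ v → Neighbour v →
    two-colouring h ≡ two-colouring (punchIn h v) ⁻¹ ⊎ Any (SameEdge (h , punchIn h v)) cut
  apex-cover v nbr with _ , t∈ ← trivial∈ neighbours-adj (∈-filter⁺ neighbour? (∈-allFin v) nbr)
    = Sum.map₁ (λ eq → trans at-apex (cong _⁻¹ (sym (trans (at-tree v)
        (trans (cong (c v ⊕_) eq) (proj₂ ℙ.+-inverse (c v))))))) (All.lookup satisfies t∈)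

  ⊕-⁻¹ : ∀ p {q} → p ⁻¹ ⊕ q ≡ (p ⊕ q) ⁻¹
  ⊕-⁻¹ 0ℙ = refl
  ⊕-⁻¹ 1ℙ = sym (ℙ.⁻¹-involutive _)

  tree-cover : ∀ u v → Adj T u v →
    two-colouring (punchIn h u) ≡ two-colouring (punchIn h v) ⁻¹ ⊎ Any (SameEdge (embed (u , v))) cut
  tree-cover u v e = Sum.map₁ (λ eq → trans (at-tree u)
      (trans (cong₂ _⊕_ (proj₂ colours e) eq) (trans (⊕-⁻¹ (c v)) (cong _⁻¹ (sym (at-tree v))))))
    (separates (proj₂ (proj₂ spanning) u) (proj₂ (proj₂ spanning) v) e)

  cover : ∀ u v → Adj graph u v → two-colouring u ≡ two-colouring v ⁻¹ ⊎ Any (SameEdge (u , v)) cut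
  cover u v e with apex-or-tree u | apex-or-tree v
  ... | inj₁ refl       | inj₁ refl       = contradiction e (Graph.irrefl graph refl)
  ... | inj₁ refl       | inj₂ (x , refl) = apex-cover x e
  ... | inj₂ (x , refl) | inj₁ refl       = Sum.map (λ eq → trans (sym (ℙ.⁻¹-involutive _)) (cong _⁻¹ (sym eq)))
                                              (Any.map SameEdge-flip) (apex-cover x (Graph.sym graph e))
  ... | inj₂ (x , refl) | inj₂ (y , refl) = tree-cover x y e

  min-max : ∃[ k ] (BalancedByDeleting (allNegative graph) k × HasOddPathPacking A k)
  min-max with F , F⊆cut , distinct , len , covers ← dedup-edges cut =
    length paths , (F , isEdgeSet , ≤-antisym (≤-trans len (≤-reflexive count)) paths≤F , balanced) , has-packing
    where
    has-packing : HasOddPathPacking A (length paths)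
    has-packing = paths , packing , refl
    isEdgeSet : IsEdgeSet graph F
    isEdgeSet = anti-mono F⊆cut cut-adj , distinct
    balanced : Balanced (deleteEdges (allNegative graph) F)
    balanced = Deletion.colourable⇒balanced graph F two-colouring λ u v e → Sum.map₂ covers (cover u v e)
    -- Weak duality for `F` shows that removing repetitions has not shortened the cut.
    paths≤F : length paths ≤ length F
    paths≤F = weak-duality (F , isEdgeSet , refl , balanced) has-packing

corollary9 : (n : ℕ) (A : ApexTree n) →
    ∃[ k ] (IsFrustrationIndex (allNegative (ApexTree.graph A)) k × IsMaximum (HasOddPathPacking A) k)
corollary9 n A with k , cut , packing ← Apex.min-max A =
  -- As `k` is attained on both sides, weak duality against each witness makes it the minimum of one
  -- and the maximum of the other.
  k , (cut , λ cut′ → Apex.weak-duality A cut′ packing) , (packing , λ packing′ → Apex.weak-duality A cut packing′)
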